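{- Let $(S,\cdot)$ be a semigroup and let $\mathcal{F}$ be a filter on $S$ such that $\bar{\mathcal{F}}$ is a subsemigroup of $\beta S$. Let $A\subseteq S$ be an $\mathcal{F}$-central set. Then there exist functions $m:\mathcal{P}_f^{\mathcal{F}}({}^{\mathbb{N}}S)\to\mathbb{N}$, $\alpha\in\prod_{F\in\mathcal{P}_f^{\mathcal{F}}({}^{\mathbb{N}}S)}S^{m(F)+1}$ and $\tau\in\prod_{F\in\mathcal{P}_f^{\mathcal{F}}({}^{\mathbb{N}}S)}\mathcal{J}_{m(F)}$ such that: (1) if $F,G\in\mathcal{P}_f^{\mathcal{F}}({}^{\mathbb{N}}S)$ and $G\subsetneq F$, then $\tau(G)(m(G))<\tau(F)(1)$; and (2) whenever $n\in\mathbb{N}$, $G_1,G_2,\ldots,G_n\in\mathcal{P}_f^{\mathcal{F}}({}^{\mathbb{N}}S)$, $G_1\subsetneq G_2\subsetneq\cdots\subsetneq G_n$, and $f_i\in G_i$ for each $i\in\{1,\ldots,n\}$, one has $$\prod_{i=1}^{n}x\bigl(m(G_i),\alpha(G_i),\tau(G_i),f_i\bigr)\in A .$$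
   Context: $\mathbb{N}=\{1,2,3,\ldots\}$; ${}^{\mathbb{N}}S$ is the set of all sequences (functions) $\mathbb{N}\to S$; $\mathcal{P}_f(X)$ is the set of nonempty finite subsets of $X$. All products $\prod$ of elements of $S$ are taken in increasing order of the indices. $\beta S$ is the Stone–Čech compactification of the discrete semigroup $S$, i.e. the set of ultrafilters on $S$, with $S$ identified with the principal ultrafilters and basic open sets $\bar A=\{p\in\beta S: A\in p\}$, $A\subseteq S$. The operation on $\beta S$ is: $A\in p\cdot q$ iff $\{x\in S: x^{ -1}A\in q\}\in p$, where $x^{ -1}A=\{y\in S: xy\in A\}$. This makes $\beta S$ a compact right topological semigroup. For a filter $\mathcal{F}$ on $S$, $\bar{\mathcal{F}}=\bigcap_{V\in\mathcal{F}}\bar V$ is the closed set of ultrafilters containing $\mathcal{F}$. When $\bar{\mathcal{F}}$ is a semigroup, $K(\bar{\mathcal{F}})$ denotes its smallest two-sided ideal. A set $A\subseteq S$ is $\mathcal{F}$-central if there is an idempotent $p\in K(\bar{\mathcal{F}})$ with $A\in p$. For $m\in\mathbb{N}$, $\mathcal{J}_m=\{(t(1),\ldots,t(m))\in\mathbb{N}^m: t(1)<\cdots<t(m)\}$. For $m\in\mathbb{N}$, $a\in S^{m+1}$, $t\in\mathcal{J}_m$, $f\in{}^{\mathbb{N}}S$, put $x(m,a,t,f)=\Bigl(\prod_{j=1}^{m}a(j)\cdot f(t(j))\Bigr)\cdot a(m+1)$. For $G\in\mathcal{P}_f({}^{\mathbb{N}}S)$ and $k\in\mathbb{N}$, $ZFP_k(G)$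 is the set of all products $\prod_{t\in H}y_t$ where $H\in\mathcal{P}_f(\mathbb{N})$, $\min H\ge k$, and $y_t\in\{g(t): g\in G\}$ for each $t\in H$. $G$ is $\mathcal{F}$-good if for every $V\in\mathcal{F}$ there is $k\in\mathbb{N}$ with $ZFP_k(G)\subseteq V$. $\mathcal{P}_f^{\mathcal{F}}({}^{\mathbb{N}}S)$ is the set of all $\mathcal{F}$-good $G\in\mathcal{P}_f({}^{\mathbb{N}}S)$. -}

module Defs where

open import Algebra.Core using (Op₂)
open import Data.Bool.Base using (Bool; true; false; not; _∧_; T)
open import Data.Bool.Properties using (T-∧)
open import Data.Fin.Base as Fin using (Fin; zero; suc; inject₁; fromℕ)
open import Data.List.Base using (List)
open import Data.List.Membership.Propositional using () renaming (_∈_ to _∈ˡ_)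
open import Data.Nat.Base as ℕ using (ℕ; zero; suc; NonZero)
open import Data.Product.Base using (Σ; ∃; _×_; _,_)
open import Data.Sum.Base using (_⊎_; inj₁; inj₂)
open import Function.Base using (_∘_; _on_)
open import Function.Bundles using (Equivalence)
open import Level using (Level)
open import Relation.Binary.Core using (Rel)
open import Relation.Binary.PropositionalEquality.Core using (_≡_)
open import Relation.Nullary.Negation.Core using (¬_)
open import Relation.Unary using (Pred)

private
  variable
    a r ℓ : Level
    X : Set a

-- The mathematics is classical: these definitions are meant to be used under
-- excluded middle and function extensionality. Every subset then has a
-- characteristic function, and subsets with the same elements are
-- propositionally equal.

𝒫 : Set a → Set a
𝒫 X = X → Bool

infix 4 _∈_ _⊆_ _⊊_

_∈_ : X → 𝒫 X → Set
x ∈ A = T (A x)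

_⊆_ : {X : Set a} → 𝒫 X → 𝒫 X → Set a
A ⊆ B = ∀ {x} → x ∈ A → x ∈ B

_⊊_ : {X : Set a} → 𝒫 X → 𝒫 X → Set a
A ⊊ B = A ⊆ B × ¬ (B ⊆ A)

∅ full : 𝒫 X
∅ _ = false
full _ = true

∁ : 𝒫 X → 𝒫 X
∁ A x = not (A x)

infixr 7 _∩_

_∩_ : 𝒫 X → 𝒫 X → 𝒫 X
(A ∩ B) x = A x ∧ B x

-- In 𝒫f, ℕ⁺, β and 𝒫fGood the proof fields are irrelevant, so that
-- elements with the same underlying data are equal. In particular a function
-- on finite subsets depends only on the subset.

record 𝒫f (X : Set a) : Set a where
  constructor mk𝒫f
  field
    set       : 𝒫 X
    .nonempty : ∃ λ x → x ∈ set
    .finite   : ∃ λ (xs : List X) → ∀ x → x ∈ set → x ∈ˡ xs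

record ℕ⁺ : Set where
  constructor mkℕ⁺
  field
    value      : ℕ
    .⦃ nonZero ⦄ : NonZero value

open ℕ⁺ public using () renaming (value to ∣_∣⁺)

infix 4 _≤⁺_ _<⁺_

_≤⁺_ _<⁺_ : Rel ℕ⁺ _
_≤⁺_ = ℕ._≤_ on ∣_∣⁺
_<⁺_ = ℕ._<_ on ∣_∣⁺

-- The index i of Fin ∣ n ∣⁺ stands for the index i + 1 of {1, …, n}.

1st : ∀ n → Fin ∣ n ∣⁺
1st (mkℕ⁺ (suc _)) = zero

last : ∀ n → Fin ∣ n ∣⁺
last (mkℕ⁺ (suc n)) = fromℕ n

Increasing : {X : Set a} → Rel X r → ∀ {n} → (Fin n → X) → Set r
Increasing _<_ y = ∀ {i j} → i Fin.< j → y i < y j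

𝒥 : ℕ⁺ → Set
𝒥 m = Σ (Fin ∣ m ∣⁺ → ℕ⁺) (Increasing _<⁺_)

record IsFilter {X : Set a} (F : 𝒫 (𝒫 X)) : Set a where
  field
    full∈    : full ∈ F
    ∅∉       : ¬ (∅ ∈ F)
    ⊆-closed : ∀ {A B} → A ⊆ B → A ∈ F → B ∈ F
    ∩-closed : ∀ {A B} → A ∈ F → B ∈ F → A ∩ B ∈ F

record IsUltrafilter {X : Set a} (p : 𝒫 (𝒫 X)) : Set a where
  field
    isFilter : IsFilter p
    ultra    : ∀ A → A ∈ p ⊎ ∁ A ∈ p
  open IsFilter isFilter public

record β (X : Set a) : Set a where
  constructor mkβ
  field
    sets           : 𝒫 (𝒫 X)
    .isUltrafilter : IsUltrafilter sets

open β public using (sets)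

-- The closed subset of β X determined by F.
cl : {X : Set a} → 𝒫 (𝒫 X) → Pred (β X) a
cl F p = F ⊆ sets p

module _ {S : Set ℓ} (_∙_ : Op₂ S) where

  infix 8 _⁻¹·_

  _⁻¹·_ : S → 𝒫 S → 𝒫 S
  (x ⁻¹· A) y = A (x ∙ y)

  mulSets : 𝒫 (𝒫 S) → 𝒫 (𝒫 S) → 𝒫 (𝒫 S)
  mulSets p q A = p (λ x → q (x ⁻¹· A))

  mulSets-isUltrafilter : ∀ {p q} → IsUltrafilter p → IsUltrafilter q →
                          IsUltrafilter (mulSets p q)
  mulSets-isUltrafilter {p} {q} P Q = record
    { isFilter = record
      { full∈    = P.⊆-closed (λ _ → Q.full∈) P.full∈
      ; ∅∉       = λ h → P.∅∉ (P.⊆-closed Q.∅∉ h)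
      ; ⊆-closed = λ A⊆B → P.⊆-closed (Q.⊆-closed A⊆B)
      ; ∩-closed = λ h k → P.⊆-closed
          (λ hk → let (h′ , k′) = Equivalence.to T-∧ hk in Q.∩-closed h′ k′)
          (P.∩-closed h k)
      }
    ; ultra = ultra
    }
    where
    module P = IsUltrafilter P
    module Q = IsUltrafilter Q

    ∁-in : ∀ B → T (not (q B)) → ∁ B ∈ q
    ∁-in B h with q B | Q.ultra B
    ... | false | inj₂ k = k

    ultra : ∀ A → A ∈ mulSets p q ⊎ ∁ A ∈ mulSets p q
    ultra A with P.ultra (λ x → q (x ⁻¹· A))
    ... | inj₁ h = inj₁ h
    ... | inj₂ h = inj₂ (P.⊆-closed (λ {x} → ∁-in (x ⁻¹· A)) h)

  mul : Op₂ (β S)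
  mul (mkβ p P) (mkβ q Q) = mkβ (mulSets p q) (mulSets-isUltrafilter P Q)

  IsSubsemigroup : Pred (β S) ℓ → Set ℓ
  IsSubsemigroup M = ∀ p q → M p → M q → M (mul p q)

  record IsIdeal (M : Pred (β S) ℓ) (I : 𝒫 (β S)) : Set ℓ where
    field
      nonempty : ∃ λ p → p ∈ I
      within   : ∀ p → p ∈ I → M p
      left     : ∀ p q → M p → q ∈ I → mul p q ∈ I
      right    : ∀ p q → M p → q ∈ I → mul q p ∈ I

  IsSmallestIdeal : Pred (β S) ℓ → 𝒫 (β S) → Set ℓ
  IsSmallestIdeal M K = IsIdeal M K × (∀ I → IsIdeal M I → K ⊆ I)

  Central : 𝒫 (𝒫 S) → 𝒫 S → Set ℓ
  Central F A = ∃ λ K → IsSmallestIdeal (cl F) K ×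
    (∃ λ p → p ∈ K × mul p p ≡ p × A ∈ sets p)

  ∏ : ∀ n → (Fin ∣ n ∣⁺ → S) → S
  ∏ (mkℕ⁺ (suc n)) = go n
    where
    go : ∀ n → (Fin (suc n) → S) → S
    go zero    y = y zero
    go (suc n) y = y zero ∙ go n (y ∘ suc)

  xProd : ∀ m → (Fin (suc ∣ m ∣⁺) → S) → 𝒥 m → (ℕ⁺ → S) → S
  xProd m a (t , _) f =
    ∏ m (λ j → a (inject₁ j) ∙ f (t j)) ∙ a (fromℕ ∣ m ∣⁺)

  -- The set H of indices is given by its increasing enumeration h, whose
  -- first term is min H.
  ZFP : ℕ⁺ → 𝒫 (ℕ⁺ → S) → Pred S ℓ
  ZFP k G s = ∃ λ n → Σ (𝒥 n) λ (h , _) → ∃ λ (y : Fin ∣ n ∣⁺ → S) →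
    k ≤⁺ h (1st n) × (∀ i → ∃ λ g → g ∈ G × y i ≡ g (h i)) × s ≡ ∏ n y

  Good : 𝒫 (𝒫 S) → 𝒫 (ℕ⁺ → S) → Set ℓ
  Good F G = ∀ V → V ∈ F → ∃ λ k → ∀ s → ZFP k G s → s ∈ V

  record 𝒫fGood (F : 𝒫 (𝒫 S)) : Set ℓ where
    constructor mk𝒫fGood
    field
      finset : 𝒫f (ℕ⁺ → S)
      .good  : Good F (𝒫f.set finset)

⟦_⟧ : {S : Set ℓ} {_∙_ : Op₂ S} {F : 𝒫 (𝒫 S)} → 𝒫fGood _∙_ F → 𝒫 (ℕ⁺ → S)
⟦ G ⟧ = 𝒫f.set (𝒫fGood.finset G)

{-# OPTIONS --safe #-}
module Submission where

-- Excluded middle for all types is a choice operator, so Zorn's lemma holds,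
-- and with it the ultrafilter lemma, idempotents in closed subsemigroups of
-- βU, and minimal closed left ideals.
--
-- Let p be an idempotent of K(cl F) with A ∈ p, and let G be good. In β(P),
-- where P is the power of S indexed by all sequences f, the ultrafilters that
-- project into cl F at each f ∈ G and contain every set of tuples
-- (x(m, a, t, f))_f with k ≤ t(1) form a closed semigroup I, stable under
-- multiplication by the diagonal image δ p. An idempotent e ∈ I · δ p projects
-- into cl F · p, where it is a right identity for p, so δ p · e is a point of I
-- all of whose projections to G equal p. Hence each B ∈ p contains
-- x(m, a, t, f) for all f ∈ G at once, with t(1) as large as desired.
--
-- The functions m, α, τ are then chosen by recursion on ⊊. With every G comes
-- a set C(G) ∈ p: put D(G) = A ∩ ⋂_{H ⊊ G} C(H), choose the values x(G, f)
-- in {x ∈ D(G) : x⁻¹D(G) ∈ p}, and let C(G) = ⋂_{f ∈ G} x(G, f)⁻¹D(G).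
-- A product over a chain starting at G then lies in D(G).

open import Defs
open import Algebra.Core using (Op₂)
open import Algebra.Structures using (IsSemigroup)
open import Axiom.ExcludedMiddle using (ExcludedMiddle)
open import Axiom.Extensionality.Propositional using (Extensionality)
open import Data.Bool.Base using (true; false; T)
open import Data.Bool.Properties using (T-∧)
open import Data.Empty using (⊥-elim)
open import Data.Fin.Base using (Fin; zero; suc)
open import Data.List.Base using (List; []; _∷_; _++_; map; filter; length)
open import Data.List.Membership.Propositional using (lose) renaming (_∈_ to _∈ˡ_)
open import Data.List.Membership.Propositional.Properties using (∈-++⁺ˡ; ∈-++⁺ʳ; ∈-map⁺; ∈-filter⁺)
open import Data.List.Properties using (filter-notAll)
open import Data.List.Relation.Unary.Any using (here; there)
open import Data.Nat.Base as ℕ using (ℕ; suc)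
import Data.Nat.Properties as ℕ
open import Data.Product.Base using (Σ; ∃; _×_; _,_; proj₁; proj₂)
open import Data.Sum.Base using (_⊎_; inj₁; inj₂)
open import Data.Unit.Base using (⊤)
import Data.Vec.Functional as Vector
open import Function.Base using (_∘_; case_of_; const)
open import Function.Bundles using (Equivalence)
open import Induction.WellFounded using (WellFounded; Acc; acc; module All; module FixPoint)
open import Level using (Level)
open import Relation.Binary.Core using (Rel)
open import Relation.Binary.PropositionalEquality
open import Relation.Nullary.Decidable using (isYes; toWitness; fromWitness; yes; no; recompute; ¬?)
open import Relation.Nullary.Negation using (¬_)
open import Relation.Unary using (Pred)

private
  variable
    a b ℓ : Level
    X Y : Set a

-- Boolean-valued subsets

T-antisym : ∀ {x y} → (T x → T y) → (T y → T x) → x ≡ y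
T-antisym {false} {false} _ _ = refl
T-antisym {false} {true}  _ g = ⊥-elim (g _)
T-antisym {true}  {false} f _ = ⊥-elim (f _)
T-antisym {true}  {true}  _ _ = refl

∁⁺ : {A : 𝒫 X} {x : X} → ¬ (x ∈ A) → x ∈ ∁ A
∁⁺ {A = A} {x} h with A x
... | true  = h _
... | false = _

∁⁻ : {A : 𝒫 X} {x : X} → x ∈ ∁ A → ¬ (x ∈ A)
∁⁻ {A = A} {x} h with A x
... | false = λ ()

∩⁺ : {A B : 𝒫 X} {x : X} → x ∈ A → x ∈ B → x ∈ A ∩ B
∩⁺ h k = Equivalence.from T-∧ (h , k)

∩⁻ : {A B : 𝒫 X} {x : X} → x ∈ A ∩ B → x ∈ A × x ∈ B
∩⁻ = Equivalence.to T-∧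

module Classical (lem : ∀ {a} → ExcludedMiddle a)
                 (funext : ∀ {a b} → Extensionality a b) where

  ⟪_⟫ : Pred X b → 𝒫 X
  ⟪ P ⟫ x = isYes (lem {P = P x})

  ⟪⟫⁺ : {P : Set a} → P → T (isYes (lem {P = P}))
  ⟪⟫⁺ = fromWitness

  ⟪⟫⁻ : {P : Set a} → T (isYes (lem {P = P})) → P
  ⟪⟫⁻ = toWitness

  byContradiction : {P : Set a} → ¬ ¬ P → P
  byContradiction {P = P} h with lem {P = P}
  ... | yes p = p
  ... | no ¬p = ⊥-elim (h ¬p)

  ⊆-antisym : {A B : 𝒫 X} → A ⊆ B → B ⊆ A → A ≡ B
  ⊆-antisym h k = funext λ _ → T-antisym h k

  ⊈⇒∃ : {A B : 𝒫 X} → ¬ (A ⊆ B) → ∃ λ x → x ∈ A × ¬ (x ∈ B)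
  ⊈⇒∃ h = byContradiction λ k →
    h λ {x} x∈A → byContradiction λ x∉B → k (x , x∈A , x∉B)

  ⋃ : 𝒫 (𝒫 X) → 𝒫 X
  ⋃ 𝒞 = ⟪ (λ x → ∃ λ A → A ∈ 𝒞 × x ∈ A) ⟫

  ⊆-⋃ : {𝒞 : 𝒫 (𝒫 X)} {A : 𝒫 X} → A ∈ 𝒞 → A ⊆ ⋃ 𝒞
  ⊆-⋃ h x∈A = ⟪⟫⁺ (_ , h , x∈A)

  ⋃-⊆ : {𝒞 : 𝒫 (𝒫 X)} {B : 𝒫 X} → (∀ {A} → A ∈ 𝒞 → A ⊆ B) → ⋃ 𝒞 ⊆ B
  ⋃-⊆ h x∈ = let _ , A∈𝒞 , x∈A = ⟪⟫⁻ x∈ in h A∈𝒞 x∈A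

  -- Zorn's lemma for families of subsets

  record Chain {X : Set a} (Q : 𝒫 X → Set b) (𝒞 : 𝒫 (𝒫 X)) : Set (a Level.⊔ b) where
    field
      nonempty : ∃ (_∈ 𝒞)
      all      : ∀ {A} → A ∈ 𝒞 → Q A
      total    : ∀ {A B} → A ∈ 𝒞 → B ∈ 𝒞 → A ⊆ B ⊎ B ⊆ A

  module Zorn {X : Set a} (Q : 𝒫 X → Set b) (Q-⋃ : ∀ {𝒞} → Chain Q 𝒞 → Q (⋃ 𝒞))
              (A₀ : 𝒫 X) (QA₀ : Q A₀) where

    next : 𝒫 X → 𝒫 X
    next A with lem {P = ∃ λ B → Q B × A ⊊ B}
    ... | yes (B , _) = B
    ... | no _ = A

    Q-next : ∀ {A} → Q A → Q (next A)
    Q-next {A} QA with lem {P = ∃ λ B → Q B × A ⊊ B}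
    ... | yes (_ , QB , _) = QB
    ... | no _ = QA

    ⊆-next : ∀ {A} → A ⊆ next A
    ⊆-next {A} with lem {P = ∃ λ B → Q B × A ⊊ B}
    ... | yes (_ , _ , A⊆B , _) = A⊆B
    ... | no _ = λ h → h

    next⊆⇒maximal : ∀ {A} → next A ⊆ A → ∀ {B} → Q B → A ⊆ B → B ⊆ A
    next⊆⇒maximal {A} with lem {P = ∃ λ B → Q B × A ⊊ B}
    ... | yes (_ , _ , _ , B⊈A) = λ h → ⊥-elim (B⊈A h)
    ... | no ∄B = λ _ QB A⊆B → byContradiction λ B⊈A → ∄B (_ , QB , A⊆B , B⊈A)

    -- The tower of the Bourbaki-Witt argument. `sup` asks for a nonempty subfamily, not a chain:
    -- comparability is derived in `total`, and only then is `Q-⋃` applied.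
    data Tower : 𝒫 X → Set a where
      base : Tower A₀
      succ : ∀ {A} → Tower A → Tower (next A)
      sup  : ∀ {𝒞} → ∃ (_∈ 𝒞) → (∀ {A} → A ∈ 𝒞 → Tower A) → Tower (⋃ 𝒞)

    base-⊆ : ∀ {A} → Tower A → A₀ ⊆ A
    base-⊆ base h = h
    base-⊆ (succ t) h = ⊆-next (base-⊆ t h)
    base-⊆ (sup (_ , A∈𝒞) ts) h = ⊆-⋃ A∈𝒞 (base-⊆ (ts A∈𝒞) h)

    Gap : 𝒫 X → Set a
    Gap A = ∀ {B} → Tower B → B ⊆ A → B ≡ A ⊎ next B ⊆ A

    -- Induction on the tower of `B`. At a union, either some member already lies above `next A` or
    -- all members lie below `A`.
    gap-compare : ∀ {A B} → Tower A → Gap A → Tower B → B ⊆ A ⊎ next A ⊆ B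
    gap-compare tA g base = inj₁ (base-⊆ tA)
    gap-compare tA g (succ tB) with gap-compare tA g tB
    ... | inj₂ A<B = inj₂ λ h → ⊆-next (A<B h)
    ... | inj₁ B⊆A with g tB B⊆A
    ...   | inj₁ refl = inj₂ λ h → h
    ...   | inj₂ B<A = inj₁ B<A
    gap-compare {A} tA g (sup {𝒞} _ ts)
      with lem {P = ∃ λ B → B ∈ 𝒞 × next A ⊆ B}
    ... | yes (_ , B∈𝒞 , A<B) = inj₂ λ h → ⊆-⋃ B∈𝒞 (A<B h)
    ... | no ∄B = inj₁ (⋃-⊆ below)
      where
      below : ∀ {B} → B ∈ 𝒞 → B ⊆ A
      below B∈𝒞 with gap-compare tA g (ts B∈𝒞)
      ... | inj₁ B⊆A = B⊆A
      ... | inj₂ A<B = ⊥-elim (∄B (_ , B∈𝒞 , A<B))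

    gap : ∀ {A} → Tower A → Gap A
    gap base tB B⊆A = inj₁ (⊆-antisym B⊆A (base-⊆ tB))
    gap (succ tA) tB B⊆A with gap-compare tA (gap tA) tB
    ... | inj₂ A<B = inj₁ (⊆-antisym B⊆A A<B)
    ... | inj₁ B⊆A′ with gap tA tB B⊆A′
    ...   | inj₁ refl = inj₂ λ h → h
    ...   | inj₂ B<A = inj₂ λ h → ⊆-next (B<A h)
    -- If the union is not inside `B`, neither is some member `C`; the gap property of `C` then puts
    -- `next B` inside `C`.
    gap (sup {𝒞} _ ts) {B} tB B⊆A with lem {P = ∃ λ C → C ∈ 𝒞 × ¬ (C ⊆ B)}
    ... | no ∄C = inj₁ (⊆-antisym B⊆A (⋃-⊆ λ C∈𝒞 → byContradiction λ C⊈B → ∄C (_ , C∈𝒞 , C⊈B)))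
    ... | yes (C , C∈𝒞 , C⊈B) with gap-compare (ts C∈𝒞) (gap (ts C∈𝒞)) tB
    ...   | inj₂ C<B = ⊥-elim (C⊈B λ h → C<B (⊆-next h))
    ...   | inj₁ B⊆C with gap (ts C∈𝒞) tB B⊆C
    ...     | inj₁ refl = ⊥-elim (C⊈B λ h → h)
    ...     | inj₂ B<C = inj₂ λ h → ⊆-⋃ C∈𝒞 (B<C h)

    total : ∀ {A B} → Tower A → Tower B → A ⊆ B ⊎ B ⊆ A
    total tA tB with gap-compare tA (gap tA) tB
    ... | inj₁ B⊆A = inj₂ B⊆A
    ... | inj₂ A<B = inj₁ λ h → A<B (⊆-next h)

    Tower⇒Q : ∀ {A} → Tower A → Q A
    Tower⇒Q base = QA₀
    Tower⇒Q (succ t) = Q-next (Tower⇒Q t)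
    Tower⇒Q (sup ne ts) = Q-⋃ record
      { nonempty = ne
      ; all      = λ h → Tower⇒Q (ts h)
      ; total    = λ h k → total (ts h) (ts k)
      }

    -- The union of the tower is in the tower, hence so is its successor, which is therefore
    -- contained in that union.
    zorn : ∃ λ M → Q M × A₀ ⊆ M × (∀ {B} → Q B → M ⊆ B → B ⊆ M)
    zorn = ⋃ ⟪ Tower ⟫ , Tower⇒Q top , base-⊆ top
         , next⊆⇒maximal (⊆-⋃ (⟪⟫⁺ (succ top)))
      where
      top : Tower (⋃ ⟪ Tower ⟫)
      top = sup (_ , ⟪⟫⁺ base) ⟪⟫⁻

  -- Filters and ultrafilters

  open IsFilter

  inhabited : {F : 𝒫 (𝒫 X)} → IsFilter F → ∀ {A} → A ∈ F → ∃ (_∈ A)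
  inhabited isF A∈F = byContradiction λ ∄x →
    ∅∉ isF (⊆-closed isF (λ h → ⊥-elim (∄x (_ , h))) A∈F)

  ⋃-isFilter : {𝒞 : 𝒫 (𝒫 (𝒫 X))} → Chain IsFilter 𝒞 → IsFilter (⋃ 𝒞)
  ⋃-isFilter {𝒞 = 𝒞} c = record
    { full∈    = ⊆-⋃ (proj₂ C.nonempty) (full∈ (C.all (proj₂ C.nonempty)))
    ; ∅∉       = λ h → let _ , F∈𝒞 , ∅∈F = ⟪⟫⁻ h in ∅∉ (C.all F∈𝒞) ∅∈F
    ; ⊆-closed = λ A⊆B h → let _ , F∈𝒞 , A∈F = ⟪⟫⁻ h in
                 ⊆-⋃ F∈𝒞 (⊆-closed (C.all F∈𝒞) A⊆B A∈F)
    ; ∩-closed = ∩-cl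
    }
    where
    module C = Chain c

    ∩-cl : ∀ {A B} → A ∈ ⋃ 𝒞 → B ∈ ⋃ 𝒞 → A ∩ B ∈ ⋃ 𝒞
    ∩-cl h k with ⟪⟫⁻ h | ⟪⟫⁻ k
    ... | _ , F∈𝒞 , A∈F | _ , G∈𝒞 , B∈G with C.total F∈𝒞 G∈𝒞
    ...   | inj₁ F⊆G = ⊆-⋃ G∈𝒞 (∩-closed (C.all G∈𝒞) (F⊆G A∈F) B∈G)
    ...   | inj₂ G⊆F = ⊆-⋃ F∈𝒞 (∩-closed (C.all F∈𝒞) A∈F (G⊆F B∈G))

  maximalFilter :
    {X : Set a} (Q : 𝒫 (𝒫 X) → Set b) →
    (∀ {𝒞} → Chain Q 𝒞 → Q (⋃ 𝒞)) →
    ∀ {F} → IsFilter F → Q F →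
    ∃ λ M → IsFilter M × Q M × F ⊆ M ×
      (∀ {N} → IsFilter N → Q N → M ⊆ N → N ⊆ M)
  maximalFilter Q Q-⋃ {F} isF QF =
    M , proj₁ QM , proj₂ QM , F⊆M , λ isN QN → maximal (isN , QN)
    where
    Q-⋃′ : ∀ {𝒞} → Chain (λ G → IsFilter G × Q G) 𝒞 → IsFilter (⋃ 𝒞) × Q (⋃ 𝒞)
    Q-⋃′ c =
        ⋃-isFilter (record { nonempty = nonempty ; all = λ h → proj₁ (all h) ; total = total })
      , Q-⋃ (record { nonempty = nonempty ; all = λ h → proj₂ (all h) ; total = total })
      where open Chain c

    Z = Zorn.zorn (λ G → IsFilter G × Q G) Q-⋃′ F (isF , QF)
    M = proj₁ Z
    QM = proj₁ (proj₂ Z)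
    F⊆M = proj₁ (proj₂ (proj₂ Z))
    maximal = proj₂ (proj₂ (proj₂ Z))

  isUltra : (p : β X) → IsUltrafilter (sets p)
  isUltra (mkβ _ u) = recompute lem u

  isFilterβ : (p : β X) → IsFilter (sets p)
  isFilterβ p = IsUltrafilter.isFilter (isUltra p)

  ∉⇒∁∈ : (p : β X) {A : 𝒫 X} → ¬ (A ∈ sets p) → ∁ A ∈ sets p
  ∉⇒∁∈ p {A} A∉p with IsUltrafilter.ultra (isUltra p) A
  ... | inj₁ h = ⊥-elim (A∉p h)
  ... | inj₂ h = h

  ∁∈⇒∉ : (p : β X) {A : 𝒫 X} → ∁ A ∈ sets p → ¬ (A ∈ sets p)
  ∁∈⇒∉ p {A} h k = ∅∉ (isFilterβ p) (⊆-closed (isFilterβ p)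
    (λ {x} m → let x∈∁A , x∈A = ∩⁻ {A = ∁ A} {A} {x} m in ∁⁻ {A = A} x∈∁A x∈A)
    (∩-closed (isFilterβ p) h k))

  β-≡ : {p q : β X} → sets p ⊆ sets q → p ≡ q
  β-≡ {X = X} {p} {q} p⊆q = lift (⊆-antisym {A = sets p} p⊆q
    λ A∈q → byContradiction λ A∉p → ∁∈⇒∉ q (p⊆q (∉⇒∁∈ p A∉p)) A∈q)
    where
    lift : {p q : β X} → sets p ≡ sets q → p ≡ q
    lift refl = refl

  extendToUltrafilter : {F : 𝒫 (𝒫 X)} → IsFilter F → ∃ (cl F)
  extendToUltrafilter {X = X} isF with maximalFilter (λ _ → ⊤) _ isF _
  ... | M , isM , _ , F⊆M , maximal = mkβ M (record { isFilter = isM ; ultra = ultra }) , F⊆M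
    where
    ultra : ∀ A → A ∈ M ⊎ ∁ A ∈ M
    ultra A with lem {P = A ∈ M}
    ... | yes A∈M = inj₁ A∈M
    ... | no A∉M = inj₂ (maximal isN _
        (λ h → ⟪⟫⁺ (⊆-closed isM (λ x∈B → ⟪⟫⁺ λ _ → x∈B) h))
        (⟪⟫⁺ (⊆-closed isM (λ _ → ⟪⟫⁺ λ h → h) (full∈ isM))))
      where
      implied : 𝒫 X → 𝒫 X
      implied B = ⟪ (λ x → x ∈ ∁ A → x ∈ B) ⟫

      -- The filter generated by `M` and `∁ A`; it is proper because `∅` in it would force `A ∈ M`.
      isN : IsFilter ⟪ (λ B → implied B ∈ M) ⟫
      isN = record
        { full∈    = ⟪⟫⁺ (⊆-closed isM (λ _ → ⟪⟫⁺ λ _ → _) (full∈ isM))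
        ; ∅∉       = λ h → A∉M (⊆-closed isM
            (λ x∈ → byContradiction λ x∉A → ⟪⟫⁻ x∈ (∁⁺ {A = A} x∉A)) (⟪⟫⁻ h))
        ; ⊆-closed = λ B⊆C h → ⟪⟫⁺ (⊆-closed isM
            (λ x∈ → ⟪⟫⁺ λ x∉A → B⊆C (⟪⟫⁻ x∈ x∉A)) (⟪⟫⁻ h))
        ; ∩-closed = λ {B} {C} h k → ⟪⟫⁺ (⊆-closed isM
            (λ {x} m → let x∈B , x∈C = ∩⁻ {A = implied B} {implied C} {x} m in
              ⟪⟫⁺ λ x∉A → ∩⁺ {A = B} {C} (⟪⟫⁻ x∈B x∉A) (⟪⟫⁻ x∈C x∉A))
            (∩-closed isM (⟪⟫⁻ h) (⟪⟫⁻ k)))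
        }

  -- Closed subsets of βX

  ker : {X : Set a} → Pred (β X) b → 𝒫 (𝒫 X)
  ker C = ⟪ (λ A → ∀ u → C u → A ∈ sets u) ⟫

  cl-ker : {C : Pred (β X) b} {u : β X} → C u → cl (ker C) u
  cl-ker u∈C A∈ = ⟪⟫⁻ A∈ _ u∈C

  -- Closedness in the Stone topology: `cl (ker C)` is the topological closure of `C`.
  Closed : {X : Set a} → Pred (β X) b → Set (a Level.⊔ b)
  Closed C = ∀ {u} → cl (ker C) u → C u

  cl-closed : (F : 𝒫 (𝒫 X)) → Closed (cl F)
  cl-closed F h A∈F = h (⟪⟫⁺ λ _ F⊆u → F⊆u A∈F)

  ker-isFilter : {C : Pred (β X) b} → ∃ C → IsFilter (ker C)
  ker-isFilter (u₀ , u₀∈C) = record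
    { full∈    = ⟪⟫⁺ λ u _ → full∈ (isFilterβ u)
    ; ∅∉       = λ h → ∅∉ (isFilterβ u₀) (⟪⟫⁻ h u₀ u₀∈C)
    ; ⊆-closed = λ A⊆B h → ⟪⟫⁺ λ u u∈C → ⊆-closed (isFilterβ u) A⊆B (⟪⟫⁻ h u u∈C)
    ; ∩-closed = λ h k → ⟪⟫⁺ λ u u∈C → ∩-closed (isFilterβ u) (⟪⟫⁻ h u u∈C) (⟪⟫⁻ k u u∈C)
    }

  MinimalClosed : {X : Set a} → (Pred (β X) a → Set b) → Pred (β X) a → Set (Level.suc a Level.⊔ b)
  MinimalClosed {a = a} {X = X} Q C =
    ∃ λ (D : Pred (β X) a) → Closed D × ∃ D × Q D × (∀ {u} → D u → C u) ×
      (∀ {E : Pred (β X) a} → Closed E → ∃ E → Q E → (∀ {u} → E u → D u) → ∀ {u} → D u → E u)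

  -- Compactness enters here: `cl` reverses inclusions, so a maximal filter gives a minimal closed
  -- set, nonempty by the ultrafilter lemma. `Q-⋃` lets `Q` pass to intersections of chains, as
  -- `cl (⋃ 𝒞)` is the intersection of the closures.
  minimalClosed :
    {X : Set a} (Q : Pred (β X) a → Set b) →
    (∀ {𝒞} → Chain (λ G → Q (cl G)) 𝒞 → Q (cl (⋃ 𝒞))) →
    (∀ {C D} → (∀ {u} → C u → D u) → (∀ {u} → D u → C u) → Q C → Q D) →
    {C : Pred (β X) a} → Closed C → ∃ C → Q C → MinimalClosed Q C
  minimalClosed Q Q-⋃ Q-resp closed ne QC
    with maximalFilter (λ G → Q (cl G)) Q-⋃ (ker-isFilter ne) (Q-resp cl-ker closed QC)
  ... | M , isM , QM , C⊆M , maximal =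
      cl M , (λ {u} → cl-closed M {u}) , extendToUltrafilter isM , QM
    , (λ M⊆u → closed λ h → M⊆u (C⊆M h))
    , λ closedE neE QE E⊆M M⊆u → closedE λ h → M⊆u (maximal (ker-isFilter neE)
        (Q-resp cl-ker closedE QE) (λ A∈M → ⟪⟫⁺ λ _ u∈E → E⊆M u∈E A∈M) h)

  -- Images of ultrafilters and the filter of tails

  pushforward : (X → Y) → β X → β Y
  pushforward φ (mkβ u isU) = mkβ (λ A → u (A ∘ φ)) (isPushforward isU)
    where
    isPushforward : ∀ {u} → IsUltrafilter u → IsUltrafilter (λ A → u (A ∘ φ))
    isPushforward isU = record
      { isFilter = record
        { full∈    = isU.full∈
        ; ∅∉       = isU.∅∉
        ; ⊆-closed = λ A⊆B → isU.⊆-closed A⊆B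
        ; ∩-closed = isU.∩-closed
        }
      ; ultra = λ A → isU.ultra (A ∘ φ)
      }
      where module isU = IsUltrafilter isU

  tails : 𝒫 (𝒫 ℕ⁺)
  tails = ⟪ (λ A → ∃ λ k → ∀ t → k ℕ.≤ ∣ t ∣⁺ → t ∈ A) ⟫

  tails-isFilter : IsFilter tails
  tails-isFilter = record
    { full∈    = ⟪⟫⁺ (0 , _)
    ; ∅∉       = λ h → let k , k≤ = ⟪⟫⁻ h in k≤ (mkℕ⁺ (suc k)) (ℕ.n≤1+n k)
    ; ⊆-closed = λ A⊆B h → let k , k≤ = ⟪⟫⁻ h in ⟪⟫⁺ (k , λ t k≤t → A⊆B (k≤ t k≤t))
    ; ∩-closed = λ {A} {B} h h′ →
        let k , k≤ = ⟪⟫⁻ h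
            l , l≤ = ⟪⟫⁻ h′ in
        ⟪⟫⁺ (k ℕ.⊔ l , λ t k⊔l≤t → ∩⁺ {A = A} {B}
          (k≤ t (ℕ.m⊔n≤o⇒m≤o k l k⊔l≤t)) (l≤ t (ℕ.m⊔n≤o⇒n≤o k l k⊔l≤t)))
    }

  -- The semigroup βU

  module Beta {U : Set ℓ} {_∙_ : Op₂ U} (isSemigroup : IsSemigroup _≡_ _∙_) where

    open IsSemigroup isSemigroup using (assoc)

    infixl 7 _⊙_ _·ʳ_

    _⊙_ : Op₂ (β U)
    _⊙_ = mul _∙_

    ⊙-assoc : ∀ p q r → (p ⊙ q) ⊙ r ≡ p ⊙ (q ⊙ r)
    ⊙-assoc p q r = β-≡ λ {A} → subst T
      (cong (sets p) (funext λ x → cong (sets q) (funext λ y → cong (sets r) (funext λ z →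
        cong A (assoc x y z)))))

    _·ʳ_ : Pred (β U) ℓ → β U → Pred (β U) ℓ
    (C ·ʳ x) r = ∃ λ y → C y × y ⊙ x ≡ r

    -- Right translation is continuous on a compact space. Concretely, a preimage `y` of `r` is any
    -- ultrafilter above the filter generated by `ker C` and the sets `pre A` with `A ∈ sets r`.
    ·ʳ-closed : {C : Pred (β U) ℓ} → ∀ x → Closed C → Closed (C ·ʳ x)
    ·ʳ-closed {C} x closed {r} h with extendToUltrafilter isN
      where
      pre : 𝒫 U → 𝒫 U
      pre A z = sets x (_⁻¹·_ _∙_ z A)

      implied : 𝒫 U → 𝒫 U → 𝒫 U
      implied A D = ⟪ (λ z → z ∈ pre A → z ∈ D) ⟫

      isN : IsFilter ⟪ (λ D → ∃ λ A → A ∈ sets r × implied A D ∈ ker C) ⟫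
      isN = record
        { full∈    = ⟪⟫⁺ (full , full∈ (isFilterβ r) , ⟪⟫⁺ λ u _ →
            ⊆-closed (isFilterβ u) (λ _ → ⟪⟫⁺ λ _ → _) (full∈ (isFilterβ u)))
        -- If every member of `C` contained the complement of `pre A`, then `∁ A` would lie in all
        -- of `C ·ʳ x`, hence in `r`.
        ; ∅∉       = λ k → let A , A∈r , A∈ = ⟪⟫⁻ k in
            ∁∈⇒∉ r (h (⟪⟫⁺ λ { _ (y , y∈C , refl) → ∉⇒∁∈ (y ⊙ x) {A} λ m →
              ∅∉ (isFilterβ y) (⊆-closed (isFilterβ y)
                (λ {z} n → let z∈ , z∈pre = ∩⁻ {A = implied A ∅} {pre A} {z} n in ⟪⟫⁻ z∈ z∈pre)
                (∩-closed (isFilterβ y) (⟪⟫⁻ A∈ y y∈C) m)) })) A∈r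
        ; ⊆-closed = λ D⊆E k → let A , A∈r , A∈ = ⟪⟫⁻ k in
            ⟪⟫⁺ (A , A∈r , ⟪⟫⁺ λ u u∈C → ⊆-closed (isFilterβ u)
              (λ z∈ → ⟪⟫⁺ λ z∈pre → D⊆E (⟪⟫⁻ z∈ z∈pre)) (⟪⟫⁻ A∈ u u∈C))
        ; ∩-closed = λ {D} {E} k l →
            let A , A∈r , A∈ = ⟪⟫⁻ k
                B , B∈r , B∈ = ⟪⟫⁻ l in
            ⟪⟫⁺ (A ∩ B , ∩-closed (isFilterβ r) A∈r B∈r , ⟪⟫⁺ λ u u∈C →
              ⊆-closed (isFilterβ u)
                (λ {z} n → let z∈A , z∈B = ∩⁻ {A = implied A D} {implied B E} {z} n in
                  ⟪⟫⁺ λ z∈pre → ∩⁺ {A = D} {E}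
                    (⟪⟫⁻ z∈A (⊆-closed (isFilterβ x)
                      (λ {w} o → proj₁ (∩⁻ {A = A} {B} {z ∙ w} o)) z∈pre))
                    (⟪⟫⁻ z∈B (⊆-closed (isFilterβ x)
                      (λ {w} o → proj₂ (∩⁻ {A = A} {B} {z ∙ w} o)) z∈pre)))
                (∩-closed (isFilterβ u) (⟪⟫⁻ A∈ u u∈C) (⟪⟫⁻ B∈ u u∈C)))
        }
    ... | y , N⊆y = y
      , closed (λ {D} D∈ → N⊆y (⟪⟫⁺ (full , full∈ (isFilterβ r) , ⟪⟫⁺ λ u u∈C →
          ⊆-closed (isFilterβ u) (λ z∈D → ⟪⟫⁺ λ _ → z∈D) (⟪⟫⁻ D∈ u u∈C))))
      , sym (β-≡ λ {A} A∈r → N⊆y (⟪⟫⁺ (A , A∈r , ⟪⟫⁺ λ u _ →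
          ⊆-closed (isFilterβ u) (λ _ → ⟪⟫⁺ λ h → h) (full∈ (isFilterβ u)))))

    fiber-closed : {C : Pred (β U) ℓ} → ∀ x r → Closed C → Closed (λ y → C y × y ⊙ x ≡ r)
    fiber-closed x r closed h =
        closed (λ A∈ → h (⟪⟫⁺ λ { u (u∈C , _) → ⟪⟫⁻ A∈ u u∈C }))
      , sym (β-≡ λ A∈r → h (⟪⟫⁺ λ { u (_ , refl) → A∈r }))

    -- The Ellis-Numakura argument. For `x` in a minimal closed subsemigroup `D`, minimality gives
    -- `D ·ʳ x` equal to `D`, so some `u` in `D` has `u ⊙ x ≡ x`. Such `u` form a closed
    -- subsemigroup, again all of `D`, and thus `x` is one of them.
    idempotent-exists : {C : Pred (β U) ℓ} → Closed C → ∃ C → IsSubsemigroup _∙_ C →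
                        ∃ λ e → C e × e ⊙ e ≡ e
    idempotent-exists {C} closed ne sub =
      conclude (minimalClosed (IsSubsemigroup _∙_) chain
        (λ C⊆D D⊆C s p q p∈D q∈D → C⊆D (s p q (D⊆C p∈D) (D⊆C q∈D))) closed ne sub)
      where
      chain : ∀ {𝒞} → Chain (λ G → IsSubsemigroup _∙_ (cl G)) 𝒞 → IsSubsemigroup _∙_ (cl (⋃ 𝒞))
      chain c p q p∈ q∈ = ⋃-⊆ λ G∈𝒞 →
        Chain.all c G∈𝒞 p q (λ h → p∈ (⊆-⋃ G∈𝒞 h)) (λ h → q∈ (⊆-⋃ G∈𝒞 h))

      conclude : MinimalClosed (IsSubsemigroup _∙_) C → ∃ λ e → C e × e ⊙ e ≡ e
      conclude (D , closedD , (x , x∈D) , subD , D⊆C , minimal) = x , D⊆C x∈D , proj₂ (D⊆fiber x∈D)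
        where
        D⊆Dx : ∀ {u} → D u → (D ·ʳ x) u
        D⊆Dx = minimal (·ʳ-closed x closedD) (_ , x , x∈D , refl)
          (λ { _ _ (y , y∈D , refl) (z , z∈D , refl) →
            y ⊙ x ⊙ z , subD _ _ (subD _ _ y∈D x∈D) z∈D , ⊙-assoc (y ⊙ x) z x })
          (λ { (y , y∈D , refl) → subD _ _ y∈D x∈D })

        D⊆fiber : ∀ {u} → D u → D u × u ⊙ x ≡ x
        D⊆fiber = minimal (fiber-closed x x closedD) (D⊆Dx x∈D)
          (λ { y z (y∈D , yx≡x) (z∈D , zx≡x) →
            subD _ _ y∈D z∈D , trans (⊙-assoc y z x) (trans (cong (y ⊙_) zx≡x) yx≡x) })
          proj₁

    -- A point l of a minimal closed left ideal L satisfies L = M ⊙ l, and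
    -- the ideal L ⊙ M contains K, so points of K inherit the property below.
    smallestIdeal-return :
      {M : Pred (β U) ℓ} {K : 𝒫 (β U)} → Closed M → IsSubsemigroup _∙_ M →
      IsSmallestIdeal _∙_ M K → ∀ {p q} → p ∈ K → M q → ∃ λ u → M u × u ⊙ (q ⊙ p) ≡ p
    smallestIdeal-return {M} {K} closed sub (idealK , smallest) {p} {q} p∈K q∈M =
      fromMinimal (minimalClosed LeftIdeal chain
        (λ C⊆D D⊆C s x y x∈M y∈D → C⊆D (s x y x∈M (D⊆C y∈D))) closed
        (_ , IsIdeal.within idealK p p∈K) sub)
      where
      LeftIdeal : Pred (β U) ℓ → Set ℓ
      LeftIdeal L = ∀ x y → M x → L y → L (x ⊙ y)

      chain : ∀ {𝒞} → Chain (λ G → LeftIdeal (cl G)) 𝒞 → LeftIdeal (cl (⋃ 𝒞))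
      chain c x y x∈M y∈ = ⋃-⊆ λ G∈𝒞 → Chain.all c G∈𝒞 x y x∈M (λ h → y∈ (⊆-⋃ G∈𝒞 h))
      fromMinimal : MinimalClosed LeftIdeal M → ∃ λ u → M u × u ⊙ (q ⊙ p) ≡ p
      fromMinimal (L , closedL , (l₀ , l₀∈L) , leftL , L⊆M , minimal) =
        conclude (⟪⟫⁻ (smallest ⟪ LM ⟫ idealLM p∈K))
        where
        L⊆Ml : ∀ {l} → L l → ∀ {u} → L u → (M ·ʳ l) u
        L⊆Ml {l} l∈L = minimal (·ʳ-closed l closed) (_ , l₀ , L⊆M l₀∈L , refl)
          (λ { x _ x∈M (y , y∈M , refl) → x ⊙ y , sub _ _ x∈M y∈M , ⊙-assoc x y l })
          (λ { (y , y∈M , refl) → leftL y l y∈M l∈L })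

        LM : Pred (β U) ℓ
        LM r = ∃ λ l → ∃ λ s → L l × M s × l ⊙ s ≡ r

        idealLM : IsIdeal _∙_ M ⟪ LM ⟫
        idealLM = record
          { nonempty = _ , ⟪⟫⁺ (l₀ , l₀ , l₀∈L , L⊆M l₀∈L , refl)
          ; within   = λ r h → within (⟪⟫⁻ h)
          ; left     = λ x r x∈M h → ⟪⟫⁺ (left x∈M (⟪⟫⁻ h))
          ; right    = λ x r x∈M h → ⟪⟫⁺ (right x∈M (⟪⟫⁻ h))
          }
          where
          within : ∀ {r} → LM r → M r
          within (l , s , l∈L , s∈M , refl) = sub l s (L⊆M l∈L) s∈M
          left : ∀ {x r} → M x → LM r → LM (x ⊙ r)
          left {x} x∈M (l , s , l∈L , s∈M , refl) =
            x ⊙ l , s , leftL x l x∈M l∈L , s∈M , ⊙-assoc x l s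
          right : ∀ {x r} → M x → LM r → LM (r ⊙ x)
          right {x} x∈M (l , s , l∈L , s∈M , refl) =
            l , s ⊙ x , l∈L , sub s x s∈M x∈M , sym (⊙-assoc l s x)

        conclude : ∀ {p} → LM p → ∃ λ u → M u × u ⊙ (q ⊙ p) ≡ p
        conclude (l , s , l∈L , s∈M , refl) =
          -- As `q ⊙ l` is in `L`, minimality returns it to `l` by some `u`; multiplying by `s` on
          -- the right carries this over to `p`.
          let u , u∈M , uql≡l = L⊆Ml (leftL q l q∈M l∈L) l∈L in u , u∈M ,
          trans (cong (u ⊙_) (sym (⊙-assoc q l s)))
            (trans (sym (⊙-assoc u (q ⊙ l) s)) (cong (_⊙ s) uql≡l))

    -- `smallestIdeal-return` writes `p` as `u ⊙ (q ⊙ p)`, so the idempotent `q ⊙ p` fixes it from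
    -- the right.
    smallestIdeal-absorb :
      {M : Pred (β U) ℓ} {K : 𝒫 (β U)} → Closed M → IsSubsemigroup _∙_ M →
      IsSmallestIdeal _∙_ M K → ∀ {p q} → p ∈ K → M q →
      (q ⊙ p) ⊙ (q ⊙ p) ≡ q ⊙ p → p ⊙ (q ⊙ p) ≡ p
    smallestIdeal-absorb closed sub isK {p} {q} p∈K q∈M idem =
      let u , _ , uqp≡p = smallestIdeal-return closed sub isK p∈K q∈M in
      trans (cong (_⊙ (q ⊙ p)) (sym uqp≡p))
        (trans (⊙-assoc u (q ⊙ p) (q ⊙ p)) (trans (cong (u ⊙_) idem) uqp≡p))

  -- Finiteness

  Finite : {I : Set a} → Pred I b → Set (a Level.⊔ b)
  Finite {I = I} P = ∃ λ (is : List I) → ∀ i → P i → i ∈ˡ is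

  -- The list may contain indices outside `P`, which impose no condition. `B` takes its proof
  -- irrelevantly, so one proof of `P i` serves for all.
  finite-⋂ : {I : Set ℓ} {P : Pred I b} {F : 𝒫 (𝒫 X)} → IsFilter F → Finite P →
             {B : ∀ i → .(P i) → 𝒫 X} → (∀ i (Pi : P i) → B i Pi ∈ F) →
             ⟪ (λ x → ∀ i (Pi : P i) → x ∈ B i Pi) ⟫ ∈ F
  finite-⋂ {I = I} {P} {F} isF (is , P⊆is) {B} h =
    ⊆-closed isF (λ x∈ → ⟪⟫⁺ λ i Pi → ⟪⟫⁻ x∈ i (P⊆is i Pi) Pi) (go is)
    where
    over : List I → 𝒫 _
    over is = ⟪ (λ x → ∀ i → i ∈ˡ is → (Pi : P i) → x ∈ B i Pi) ⟫

    go : ∀ is → over is ∈ F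
    go [] = ⊆-closed isF (λ _ → ⟪⟫⁺ λ _ ()) (full∈ isF)
    go (i ∷ is) with lem {P = P i}
    ... | no ¬Pi = ⊆-closed isF
        (λ x∈ → ⟪⟫⁺ λ { _ (here refl) Pi → ⊥-elim (¬Pi Pi) ; j (there j∈) Pj → ⟪⟫⁻ x∈ j j∈ Pj })
        (go is)
    ... | yes Pi = ⊆-closed isF
        (λ {x} n → let x∈B , x∈ = ∩⁻ {A = B i Pi} {over is} {x} n in
          ⟪⟫⁺ λ { _ (here refl) _ → x∈B ; j (there j∈) Pj → ⟪⟫⁻ x∈ j j∈ Pj })
        (∩-closed isF (h i Pi) (go is))

  finite-subsets : (xs : List X) → Finite (λ (A : 𝒫 X) → ∀ x → x ∈ A → x ∈ˡ xs)
  finite-subsets [] = ∅ ∷ [] , λ A A⊆ → here (⊆-antisym (λ h → case A⊆ _ h of λ ()) λ ())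
  finite-subsets {X = X} (x ∷ xs) with finite-subsets xs
  ... | As , complete = As ++ map insert As , complete′
    where
    insert : 𝒫 X → 𝒫 X
    insert A = ⟪ (λ y → y ≡ x ⊎ y ∈ A) ⟫

    remove : 𝒫 X → 𝒫 X
    remove A = ⟪ (λ y → y ≢ x × y ∈ A) ⟫

    insert-remove : ∀ {A} → x ∈ A → A ≡ insert (remove A)
    insert-remove {A} x∈A = ⊆-antisym (λ {y} y∈A → ⟪⟫⁺ (split y∈A))
      (λ h → join (⟪⟫⁻ h))
      where
      split : ∀ {y} → y ∈ A → y ≡ x ⊎ y ∈ remove A
      split {y} y∈A with lem {P = y ≡ x}
      ... | yes y≡x = inj₁ y≡x
      ... | no y≢x = inj₂ (⟪⟫⁺ (y≢x , y∈A))
      join : ∀ {y} → y ≡ x ⊎ y ∈ remove A → y ∈ A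
      join (inj₁ refl) = x∈A
      join (inj₂ h) = proj₂ (⟪⟫⁻ h)

    complete′ : ∀ A → (∀ y → y ∈ A → y ∈ˡ x ∷ xs) → A ∈ˡ As ++ map insert As
    complete′ A A⊆ with lem {P = x ∈ A}
    ... | no x∉A = ∈-++⁺ˡ (complete A λ y y∈A → case A⊆ y y∈A of λ
          { (here refl) → ⊥-elim (x∉A y∈A) ; (there y∈xs) → y∈xs })
    ... | yes x∈A = ∈-++⁺ʳ As (subst (_∈ˡ map insert As) (sym (insert-remove x∈A))
          (∈-map⁺ insert (complete (remove A) λ y h →
            let y≢x , y∈A = ⟪⟫⁻ h in case A⊆ y y∈A of λ
            { (here y≡x) → ⊥-elim (y≢x y≡x) ; (there y∈xs) → y∈xs })))

  finite-preimage : {I : Set a} {J : Set b} {φ : I → J} {P : Pred J ℓ} →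
                    (∀ {i j} → φ i ≡ φ j → i ≡ j) → Finite P → Finite (P ∘ φ)
  finite-preimage {I = I} {J} {φ} injective (js , P⊆js) =
    let is , complete = go js in is , λ i Pφi → complete i (P⊆js (φ i) Pφi)
    where
    go : ∀ js → ∃ λ (is : List I) → ∀ i → φ i ∈ˡ js → i ∈ˡ is
    go [] = [] , λ _ ()
    go (j ∷ js) with go js | lem {P = ∃ λ i → φ i ≡ j}
    ... | is , complete | no ∄i = is , λ
      { i (here φi≡j) → ⊥-elim (∄i (i , φi≡j)) ; i (there h) → complete i h }
    ... | is , complete | yes (i₀ , refl) = i₀ ∷ is , λ
      { i (here φi≡j) → here (injective φi≡j) ; i (there h) → there (complete i h) }

  -- Each proper step down loses some `x`, which is filtered out of the covering list; `n` bounds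
  -- the length of that list.
  ⊊-accessible : {I : Set b} (φ : I → 𝒫 X) (xs : List X) → ∀ n → length xs ℕ.< n →
                 ∀ i → (∀ x → x ∈ φ i → x ∈ˡ xs) → Acc (λ j k → φ j ⊊ φ k) i
  ⊊-accessible φ xs (suc n) (ℕ.s≤s len≤n) i φi⊆xs = acc λ {j} (φj⊆φi , φi⊈φj) →
    let x , x∈φi , x∉φj = ⊈⇒∃ φi⊈φj
        ≢x? = λ y → ¬? (lem {P = y ≡ x}) in
    ⊊-accessible φ (filter ≢x? xs) n
      (ℕ.<-≤-trans (filter-notAll ≢x? xs
        (lose (φi⊆xs x x∈φi) λ x≢x → x≢x refl)) len≤n)
      j λ y y∈φj → ∈-filter⁺ ≢x? (φi⊆xs y (φj⊆φi y∈φj)) λ { refl → x∉φj y∈φj }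

  -- The proofs of j < i are irrelevant, so that the earlier values form a
  -- finite family whenever i has finitely many predecessors.
  wf-choice : {I : Set a} {_<_ : Rel I b} {P : I → Set ℓ} → WellFounded _<_ →
    ∀ {r} (R : ∀ i → (∀ j → .(j < i) → P j) → P i → Set r) →
    (∀ i (prior : ∀ j → .(j < i) → P j) → ∃ (R i prior)) →
    Σ (∀ i → P i) λ f → ∀ i → R i (λ j _ → f j) (f i)
  wf-choice {_<_ = _<_} {P} wf R step = f , λ i →
    subst (R i _) (sym unfold-wfRec) (proj₂ (step i _))
    where
    body : ∀ i → (∀ {j} → j < i → P j) → P i
    body i prior = proj₁ (step i λ _ j<i → prior (recompute lem j<i))

    f = All.wfRec wf _ P body

    open FixPoint wf P body (λ i eq →
      cong (λ prior → body i λ {j} → prior j) (funext λ _ → funext eq))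

  -- Good sets of sequences

  module _ {S : Set ℓ} {_∙_ : Op₂ S} (isSemigroup : IsSemigroup _≡_ _∙_)
           {F : 𝒫 (𝒫 S)} (F-sub : IsSubsemigroup _∙_ (cl F)) where

    open IsSemigroup isSemigroup using (assoc)

    finite : (G : 𝒫fGood _∙_ F) → Finite (_∈ ⟦ G ⟧)
    finite (mk𝒫fGood (mk𝒫f _ _ fin) _) = recompute lem fin

    good : (G : 𝒫fGood _∙_ F) → Good _∙_ F ⟦ G ⟧
    good (mk𝒫fGood _ g) = recompute lem g

    ⟦⟧-injective : {G H : 𝒫fGood _∙_ F} → ⟦ G ⟧ ≡ ⟦ H ⟧ → G ≡ H
    ⟦⟧-injective refl = refl

    finite-⊊ : (G : 𝒫fGood _∙_ F) → Finite (λ (H : 𝒫fGood _∙_ F) → ⟦ H ⟧ ⊊ ⟦ G ⟧)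
    finite-⊊ G =
      let fs , G⊆fs = finite G
          Hs , complete = finite-preimage {φ = ⟦_⟧} ⟦⟧-injective (finite-subsets fs) in
      Hs , λ { H (H⊆G , _) → complete H λ f f∈H → G⊆fs f (H⊆G f∈H) }

    ⊊-wellFounded : WellFounded (λ (H G : 𝒫fGood _∙_ F) → ⟦ H ⟧ ⊊ ⟦ G ⟧)
    ⊊-wellFounded G = let fs , G⊆fs = finite G in
      ⊊-accessible ⟦_⟧ fs _ ℕ.≤-refl G G⊆fs

    -- Tuples indexed by all sequences

    Power : Set ℓ
    Power = (ℕ⁺ → S) → S

    infixl 7 _∙ᵖ_

    _∙ᵖ_ : Op₂ Power
    (x ∙ᵖ y) f = x f ∙ y f

    power-isSemigroup : IsSemigroup _≡_ _∙ᵖ_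
    power-isSemigroup = record
      { isMagma = record { isEquivalence = isEquivalence ; ∙-cong = cong₂ _∙ᵖ_ }
      ; assoc   = λ x y z → funext λ f → assoc (x f) (y f) (z f)
      }

    -- x is the tuple of all x(m, a, t, f), for some m, a and t with k ≤ t(1).
    data Spread (k : ℕ) (x : Power) : Set ℓ where
      end  : ∀ c t d → k ℕ.≤ ∣ t ∣⁺ → (∀ f → x f ≡ (c ∙ f t) ∙ d) → Spread k x
      step : ∀ c t {y} → k ℕ.≤ ∣ t ∣⁺ → Spread (suc ∣ t ∣⁺) y →
             (∀ f → x f ≡ (c ∙ f t) ∙ y f) → Spread k x

    const-∙-spread : ∀ d {k x} → Spread k x → Spread k (const d ∙ᵖ x)
    const-∙-spread d (end c t d′ k≤t eq) = end (d ∙ c) t d′ k≤t λ f →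
      trans (cong (d ∙_) (eq f)) (trans (sym (assoc _ _ _)) (cong (_∙ d′) (sym (assoc _ _ _))))
    const-∙-spread d (step c t {y} k≤t s eq) = step (d ∙ c) t k≤t s λ f →
      trans (cong (d ∙_) (eq f)) (trans (sym (assoc _ _ _)) (cong (_∙ y f) (sym (assoc _ _ _))))

    spread-∙-const : ∀ d {k x} → Spread k x → Spread k (x ∙ᵖ const d)
    spread-∙-const d (end c t d′ k≤t eq) = end c t (d′ ∙ d) k≤t λ f →
      trans (cong (_∙ d) (eq f)) (assoc _ _ _)
    spread-∙-const d (step c t k≤t s eq) = step c t k≤t (spread-∙-const d s) λ f →
      trans (cong (_∙ d) (eq f)) (assoc _ _ _)

    -- `l` lies just past the last index of `x`, so indices keep increasing; the closing coefficient
    -- of `x` merges into the first one of `y`.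
    spread-∙-spread : ∀ {k x} → Spread k x → ∃ λ l → ∀ {y} → Spread l y → Spread k (x ∙ᵖ y)
    spread-∙-spread (end c t d k≤t eq) = suc ∣ t ∣⁺ , λ {y} s →
      step c t k≤t (const-∙-spread d s) λ f → trans (cong (_∙ y f) (eq f)) (assoc _ _ _)
    spread-∙-spread (step c t k≤t s eq) = let l , h = spread-∙-spread s in l , λ {y} s′ →
      step c t k≤t (h s′) λ f → trans (cong (_∙ y f) (eq f)) (assoc _ _ _)

    -- The bound is claimed for every index: applied to the tail, it is the monotonicity needed
    -- after prepending `t`.
    spread⇒xProd : ∀ {k x} → Spread k x →
      ∃ λ n → let m = mkℕ⁺ (suc n) in
      ∃ λ (c : Fin (suc ∣ m ∣⁺) → S) → Σ (𝒥 m) λ t →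
        (∀ i → k ℕ.≤ ∣ proj₁ t i ∣⁺) × (∀ f → x f ≡ xProd _∙_ m c t f)
    spread⇒xProd (end c t d k≤t eq) =
      0 , c Vector.∷ const d , (const t , λ { {zero} {zero} () }) , (λ _ → k≤t) , eq
    spread⇒xProd {k} (step c t k≤t s eq) =
      let n , c′ , (t′ , t′-inc) , t<t′ , eq′ = spread⇒xProd s in
      suc n , c Vector.∷ c′
        , (t Vector.∷ t′ , λ { {zero}  {suc j} _         → t<t′ j
                             ; {suc i} {suc j} (ℕ.s≤s h) → t′-inc h })
        , (λ { zero    → k≤t
             ; (suc i) → ℕ.≤-trans k≤t (ℕ.<⇒≤ (t<t′ i)) })
        , λ f → trans (eq f) (trans (cong ((c ∙ f t) ∙_) (eq′ f)) (sym (assoc _ _ _)))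

    open Beta isSemigroup
    open Beta power-isSemigroup using ()
      renaming (_⊙_ to _⊙ᵖ_; ⊙-assoc to ⊙ᵖ-assoc; _·ʳ_ to _·ᵖ_; ·ʳ-closed to ·ᵖ-closed;
                idempotent-exists to idempotentᵖ-exists)

    -- Each `π f` is a homomorphism and `π f (δ q)` is `q`, both by computation, so facts about
    -- `cl F` apply to projections without transport.
    π : (ℕ⁺ → S) → β Power → β S
    π f = pushforward (λ x → x f)

    δ : β S → β Power
    δ = pushforward const

    -- Ultrafilters of tuples for one good set

    module _ (G : 𝒫fGood _∙_ F) where

      I : Pred (β Power) ℓ
      I u = (∀ f → f ∈ ⟦ G ⟧ → cl F (π f u)) × (∀ k → ⟪ Spread k ⟫ ∈ sets u)

      I-closed : Closed I
      I-closed h = (λ f f∈G V∈F → h (⟪⟫⁺ λ _ (u∈F , _) → u∈F f f∈G V∈F))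
                 , (λ k → h (⟪⟫⁺ λ _ (_ , u∈) → u∈ k))

      -- The bound of `spread-∙-spread` varies with the left factor, which is why points of `I`
      -- contain `Spread k` for every `k`.
      I-⊙-I : ∀ u v → I u → I v → I (u ⊙ᵖ v)
      I-⊙-I u v (u∈F , u∈) (v∈F , v∈) =
          (λ f f∈G → F-sub (π f u) (π f v) (u∈F f f∈G) (v∈F f f∈G))
        , λ k → ⊆-closed (isFilterβ u)
            (λ x∈ → let l , h = spread-∙-spread (⟪⟫⁻ x∈) in
              ⊆-closed (isFilterβ v) (λ y∈ → ⟪⟫⁺ (h (⟪⟫⁻ y∈))) (v∈ l))
            (u∈ k)

      I-⊙-δ : ∀ u q → I u → cl F q → I (u ⊙ᵖ δ q)
      I-⊙-δ u q (u∈F , u∈) q∈F =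
          (λ f f∈G → F-sub (π f u) q (u∈F f f∈G) q∈F)
        , λ k → ⊆-closed (isFilterβ u)
            (λ x∈ → ⊆-closed (isFilterβ q) (λ {d} _ → ⟪⟫⁺ (spread-∙-const d (⟪⟫⁻ x∈)))
              (full∈ (isFilterβ q)))
            (u∈ k)

      δ-⊙-I : ∀ u q → cl F q → I u → I (δ q ⊙ᵖ u)
      δ-⊙-I u q q∈F (u∈F , u∈) =
          (λ f f∈G → F-sub q (π f u) q∈F (u∈F f f∈G))
        , λ k → ⊆-closed (isFilterβ q)
            (λ {d} _ → ⊆-closed (isFilterβ u) (λ x∈ → ⟪⟫⁺ (const-∙-spread d (⟪⟫⁻ x∈))) (u∈ k))
            (full∈ (isFilterβ q))

      -- `S` may lack an identity, so the two factors `δ q` supply the coefficients around `f t`,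
      -- while `v` lets `t` tend to infinity.
      I-nonempty : ∀ {q} → cl F q → ∃ I
      I-nonempty {q} q∈F = δ q ⊙ᵖ (v ⊙ᵖ δ q)
        , (λ f f∈G → F-sub q (π f v ⊙ q) q∈F (F-sub (π f v) q (v∈F f f∈G) q∈F))
        , λ k → ⊆-closed (isFilterβ q)
            (λ {c} _ → ⊆-closed (isFilterβ u₀)
              (λ {t} k≤t → ⊆-closed (isFilterβ q)
                (λ {d} _ → ⟪⟫⁺ (end c t d (⟪⟫⁻ k≤t) λ f → sym (assoc c (f t) d)))
                (full∈ (isFilterβ q)))
              (tails⊆u₀ (⟪⟫⁺ (k , λ _ k≤t → ⟪⟫⁺ k≤t))))
            (full∈ (isFilterβ q))
        where
        u₀ = proj₁ (extendToUltrafilter tails-isFilter)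
        tails⊆u₀ = proj₂ (extendToUltrafilter tails-isFilter)

        v : β Power
        v = pushforward (λ t f → f t) u₀

        v∈F : ∀ f → f ∈ ⟦ G ⟧ → cl F (π f v)
        -- `f t` is the product over the one-element index set of `t`, so goodness puts it in `V`
        -- for all large `t`.
        v∈F f f∈G {V} V∈F = let k , h = good G V V∈F in
          tails⊆u₀ (⟪⟫⁺ (∣ k ∣⁺ , λ t k≤t → h (f t)
            ( mkℕ⁺ 1 , (const t , λ { {zero} {zero} () }) , const (f t)
            , k≤t , (λ _ → f , f∈G , refl) , refl )))

      -- With e = u ⊙ δ p idempotent, p ⊙ π f e = p for every f in G, because
      -- p lies in the smallest ideal; so δ p ⊙ e is a point of I over p.
      I-over : ∀ {K p} → IsSmallestIdeal _∙_ (cl F) K → p ∈ K →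
               ∃ λ w → I w × (∀ f → f ∈ ⟦ G ⟧ → π f w ≡ p)
      I-over {K} {p} isK p∈K = over (idempotentᵖ-exists (·ᵖ-closed (δ p) λ {u} → I-closed {u})
          (let u , u∈I = I-nonempty {p} p∈F in u ⊙ᵖ δ p , u , u∈I , refl) subsemigroup)
        where
        p∈F : cl F p
        p∈F = IsIdeal.within (proj₁ isK) p p∈K

        subsemigroup : IsSubsemigroup _∙ᵖ_ (I ·ᵖ δ p)
        subsemigroup _ _ (u , u∈I , refl) (v , v∈I , refl) =
          (u ⊙ᵖ δ p) ⊙ᵖ v , I-⊙-I (u ⊙ᵖ δ p) v (I-⊙-δ u p u∈I p∈F) v∈I , ⊙ᵖ-assoc (u ⊙ᵖ δ p) v (δ p)

        over : (∃ λ e → (I ·ᵖ δ p) e × e ⊙ᵖ e ≡ e) →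
               ∃ λ w → I w × (∀ f → f ∈ ⟦ G ⟧ → π f w ≡ p)
        over (_ , (u , u∈I , refl) , idem) = δ p ⊙ᵖ (u ⊙ᵖ δ p) , δ-⊙-I (u ⊙ᵖ δ p) p p∈F (I-⊙-δ u p u∈I p∈F)
          , λ f f∈G → smallestIdeal-absorb (λ {u} → cl-closed F {u}) F-sub isK {q = π f u} p∈K
              (proj₁ u∈I f f∈G) (cong (π f) idem)

      -- As `G` is finite, the tuples with all `G`-coordinates in `B` form a set in the ultrafilter
      -- from `I-over`; it therefore meets `Spread`.
      xProd∈ : ∀ {K p} → IsSmallestIdeal _∙_ (cl F) K → p ∈ K →
        ∀ {B} → B ∈ sets p → ∀ k →
        ∃ λ m → ∃ λ (c : Fin (suc ∣ m ∣⁺) → S) → Σ (𝒥 m) λ t →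
          k ≤⁺ proj₁ t (1st m) × (∀ f → f ∈ ⟦ G ⟧ → xProd _∙_ m c t f ∈ B)
      xProd∈ {p = p} isK p∈K {B} B∈p k = fromSpread (fromPoint (I-over isK p∈K))
        where
        fromPoint : (∃ λ w → I w × (∀ f → f ∈ ⟦ G ⟧ → π f w ≡ p)) →
                    ∃ λ x → Spread ∣ k ∣⁺ x × (∀ f → f ∈ ⟦ G ⟧ → x f ∈ B)
        fromPoint (w , (_ , w∈) , over) =
          let x , x∈ = inhabited (isFilterβ w) (∩-closed (isFilterβ w) (w∈ ∣ k ∣⁺)
                (finite-⋂ (isFilterβ w) (finite G) {B = λ f _ x → B (x f)}
                  λ f f∈G → subst (λ q → B ∈ sets q) (sym (over f f∈G)) B∈p))
              spread , x∈B = ∩⁻ {A = ⟪ Spread ∣ k ∣⁺ ⟫} {⟪ (λ x → ∀ f → f ∈ ⟦ G ⟧ → x f ∈ B) ⟫} {x} x∈ in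
          x , ⟪⟫⁻ spread , ⟪⟫⁻ x∈B

        fromSpread : (∃ λ x → Spread ∣ k ∣⁺ x × (∀ f → f ∈ ⟦ G ⟧ → x f ∈ B)) → _
        fromSpread (x , spread , x∈B) =
          let n , c , t , k≤t , eq = spread⇒xProd spread in
          mkℕ⁺ (suc n) , c , t , k≤t zero , λ f f∈G → subst (_∈ B) (eq f) (x∈B f f∈G)

    -- Recursion along proper inclusion

    module _ {K : 𝒫 (β S)} {p : β S} (isK : IsSmallestIdeal _∙_ (cl F) K) (p∈K : p ∈ K)
             (idem : p ⊙ p ≡ p) {A : 𝒫 S} (A∈p : A ∈ sets p) where

      star : 𝒫 S → 𝒫 S
      star D x = sets p (_⁻¹·_ _∙_ x D)

      -- `star D ∈ sets p` unfolds to `D ∈ sets (p ⊙ p)`.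
      star∈ : ∀ {D} → D ∈ sets p → star D ∈ sets p
      star∈ {D} = subst (λ q → D ∈ sets q) (sym idem)

      record Choice : Set ℓ where
        field
          m       : ℕ⁺
          α       : Fin (suc ∣ m ∣⁺) → S
          τ       : 𝒥 m
          after   : 𝒫 S
          after∈p : after ∈ sets p

        value : (ℕ⁺ → S) → S
        value = xProd _∙_ m α τ

      open Choice

      Prior : 𝒫fGood _∙_ F → Set ℓ
      Prior G = ∀ (H : 𝒫fGood _∙_ F) → .(⟦ H ⟧ ⊊ ⟦ G ⟧) → Choice

      -- y may be the product of a chain starting at G: it lies in A, and it
      -- may follow any factor indexed by a proper subset of G.
      Admissible : ∀ G → Prior G → Pred S ℓ
      Admissible G prior y =
        y ∈ A × (∀ H (H⊊G : ⟦ H ⟧ ⊊ ⟦ G ⟧) → y ∈ after (prior H H⊊G))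

      record Extends (G : 𝒫fGood _∙_ F) (prior : Prior G) (c : Choice) : Set ℓ where
        field
          later : ∀ H (H⊊G : ⟦ H ⟧ ⊊ ⟦ G ⟧) →
                  let d = prior H H⊊G in proj₁ (τ d) (last (m d)) <⁺ proj₁ (τ c) (1st (m c))
          single  : ∀ f → f ∈ ⟦ G ⟧ → Admissible G prior (value c f)
          product : ∀ f → f ∈ ⟦ G ⟧ → ∀ {y} → y ∈ after c → Admissible G prior (value c f ∙ y)

      extend : ∀ G (prior : Prior G) → ∃ (Extends G prior)
      -- `k` is a common point of finitely many tails, one past the last index of each earlier
      -- choice.
      extend G prior = fromBound (inhabited tails-isFilter
          (finite-⋂ tails-isFilter (finite-⊊ G)
            {B = λ H H⊊G → let d = prior H H⊊G in ⟪ (λ k → proj₁ (τ d) (last (m d)) <⁺ k) ⟫}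
            λ H H⊊G → ⟪⟫⁺ (_ , λ _ h → ⟪⟫⁺ h)))
        where
        followsPrior D : 𝒫 S
        followsPrior = ⟪ (λ y → ∀ H (H⊊G : ⟦ H ⟧ ⊊ ⟦ G ⟧) → y ∈ after (prior H H⊊G)) ⟫
        D = ⟪ Admissible G prior ⟫

        D∈p : D ∈ sets p
        D∈p = ⊆-closed (isFilterβ p)
          (λ {y} h → let y∈A , y∈ = ∩⁻ {A = A} {followsPrior} {y} h in ⟪⟫⁺ (y∈A , ⟪⟫⁻ y∈))
          (∩-closed (isFilterβ p) A∈p
            (finite-⋂ (isFilterβ p) (finite-⊊ G) {B = λ H H⊊G → after (prior H H⊊G)}
              λ H H⊊G → after∈p (prior H H⊊G)))

        fromBound : (∃ λ k → k ∈ ⟪ (λ k → ∀ H (H⊊G : ⟦ H ⟧ ⊊ ⟦ G ⟧) →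
                      k ∈ ⟪ (λ k → let d = prior H H⊊G in proj₁ (τ d) (last (m d)) <⁺ k) ⟫) ⟫) →
                    ∃ (Extends G prior)
        fromBound (k , bound) = build
          -- Values in `D` give `single`; values in `star D` put the new `after` in `p`.
          (xProd∈ G isK p∈K (∩-closed (isFilterβ p) D∈p (star∈ D∈p)) k)
          where
          build : (∃ λ m → ∃ λ (c : Fin (suc ∣ m ∣⁺) → S) → Σ (𝒥 m) λ t →
                    k ≤⁺ proj₁ t (1st m) × (∀ f → f ∈ ⟦ G ⟧ → xProd _∙_ m c t f ∈ D ∩ star D)) →
                  ∃ (Extends G prior)
          build (m , c , t , k≤t , x∈) =
              record
                { m = m ; α = c ; τ = t
                ; after   = ⟪ (λ y → ∀ f → f ∈ ⟦ G ⟧ → (xProd _∙_ m c t f ∙ y) ∈ D) ⟫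
                ; after∈p = finite-⋂ (isFilterβ p) (finite G)
                    {B = λ f _ → _⁻¹·_ _∙_ (xProd _∙_ m c t f) D}
                    λ f f∈G → proj₂ (∩⁻ {A = D} {star D} {xProd _∙_ m c t f} (x∈ f f∈G))
                }
            , record
                { later   = λ H H⊊G → ℕ.<-≤-trans (⟪⟫⁻ (⟪⟫⁻ bound H H⊊G)) k≤t
                ; single  = λ f f∈G →
                    ⟪⟫⁻ (proj₁ (∩⁻ {A = D} {star D} {xProd _∙_ m c t f} (x∈ f f∈G)))
                ; product = λ f f∈G y∈ → ⟪⟫⁻ (⟪⟫⁻ y∈ f f∈G)
                }

      Choices : Set ℓ
      Choices = Σ (𝒫fGood _∙_ F → Choice) λ c → ∀ G → Extends G (λ H _ → c H) (c G)

      choices : Choices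
      choices = wf-choice ⊊-wellFounded Extends extend

      ∏∈A : ((c , _) : Choices) → ∀ n (G : Fin ∣ n ∣⁺ → 𝒫fGood _∙_ F) →
            Increasing (λ H K → ⟦ H ⟧ ⊊ ⟦ K ⟧) G →
            (f : Fin ∣ n ∣⁺ → ℕ⁺ → S) → (∀ i → f i ∈ ⟦ G i ⟧) →
            ∏ _∙_ n (λ i → value (c (G i)) (f i)) ∈ A
      ∏∈A (c , extends) (mkℕ⁺ (suc n)) G inc f f∈G = proj₁ (admissible n G inc f f∈G)
        where
        -- Membership in `A` alone would not survive the induction: the product of the remaining
        -- factors must also lie in `after` of the first choice.
        admissible : ∀ n (G : Fin (suc n) → 𝒫fGood _∙_ F) →
          Increasing (λ H K → ⟦ H ⟧ ⊊ ⟦ K ⟧) G →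
          (f : Fin (suc n) → ℕ⁺ → S) → (∀ i → f i ∈ ⟦ G i ⟧) →
          Admissible (G zero) (λ H _ → c H)
            (∏ _∙_ (mkℕ⁺ (suc n)) λ i → value (c (G i)) (f i))
        admissible ℕ.zero G inc f f∈G = Extends.single (extends (G zero)) (f zero) (f∈G zero)
        admissible (suc n) G inc f f∈G =
          Extends.product (extends (G zero)) (f zero) (f∈G zero)
            (proj₂ (admissible n (G ∘ suc) (λ i<j → inc (ℕ.s≤s i<j)) (f ∘ suc) (f∈G ∘ suc))
              (G zero) (inc (ℕ.s≤s ℕ.z≤n)))

theorem1p9 : (lem : ∀ {a} → ExcludedMiddle a) →
    (funext : ∀ {a b} → Extensionality a b) →
    ∀ {ℓ} (S : Set ℓ) (_∙_ : Op₂ S) → IsSemigroup _≡_ _∙_ →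
    (F : 𝒫 (𝒫 S)) → IsFilter F → IsSubsemigroup _∙_ (cl F) →
    (A : 𝒫 S) → Central _∙_ F A →
    Σ (𝒫fGood _∙_ F → ℕ⁺) λ m →
    Σ (∀ G → Fin (suc ∣ m G ∣⁺) → S) λ α →
    Σ (∀ G → 𝒥 (m G)) λ τ →
    (∀ H G → ⟦ G ⟧ ⊊ ⟦ H ⟧ →
    proj₁ (τ G) (last (m G)) <⁺ proj₁ (τ H) (1st (m H)))
    ×
    (∀ n (G : Fin ∣ n ∣⁺ → 𝒫fGood _∙_ F) →
    Increasing (λ H K → ⟦ H ⟧ ⊊ ⟦ K ⟧) G →
    (f : Fin ∣ n ∣⁺ → ℕ⁺ → S) → (∀ i → f i ∈ ⟦ G i ⟧) →
    ∏ _∙_ n (λ i → xProd _∙_ (m (G i)) (α (G i)) (τ (G i)) (f i)) ∈ A)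
theorem1p9 lem funext S _∙_ isSemigroup F isFilter F-sub A (K , isK , p , p∈K , idem , A∈p) =
  conclude (choices isSemigroup F-sub isK p∈K idem A∈p)
  where
  open Classical lem funext

  conclude : Choices isSemigroup F-sub isK p∈K idem A∈p → _
  conclude (c , extends) =
      (λ G → Choice.m (c G)) , (λ G → Choice.α (c G)) , (λ G → Choice.τ (c G))
    , (λ H G G⊊H → Extends.later (extends H) G G⊊H)
    , ∏∈A isSemigroup F-sub isK p∈K idem A∈p (c , extends)
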